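{- Let $X$ be an $m$-edge orbital toroidal map which is either semi-equivelar or edge-homogeneous of edge-symbol $(4,4;3,6)$, and let $Y$ be a $k$-edge orbital toroidal map with a covering $Y\to X$. Then there exists a covering $\eta\colon Z\to X$ where $Z$ is $k$-edge orbital and $Z$ is minimal, i.e. among all $k$-edge orbital maps covering $X$, $Z$ has the minimal number of edges.
   Context: A map is an embedding of a graph on a surface such that the closures of the components of the complement of the graph (the faces) are closed 2-discs, and any two distinct faces intersect in the empty set, a common vertex, or a common edge; a toroidal map is a map on the torus. A map is semi-equivelar if the cyclic sequences of face sizes around all vertices are of the same type. An edge has edge-symbol $(m,\ell;u,v)$ if its end vertices have valences $u,v$ and its incident faces have sizes $m,\ell$; being of edge-symbol $(4,4;3,6)$ means all edges have this symbol. A map is $k$-edge orbital if its edge set splits into exactly $k$ orbits under its automorphism group. A covering $\eta\colon Z\to X$ of maps is a surjective topological covering map which preserves adjacency and sends vertices, edges and faces to vertices, edges and faces. -}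

module Defs where

open import Data.Bool.Base using (Bool; not)
open import Data.Fin.Base using (Fin; toℕ)
open import Data.List.Base using (List; length; lookup)
open import Data.Nat.Base using (ℕ; _+_; _<_)
open import Data.Nat.GeneralisedArithmetic using (fold)
open import Data.Product.Base using (Σ; ∃; _×_; _,_; proj₁)
open import Data.Sum.Base using (_⊎_)
open import Function.Base using (_∘_)
open import Function.Bundles using (_⇔_)
open import Function.Definitions using (Bijective; Injective; Surjective)
open import Level using (Level)
open import Relation.Binary.Construct.Closure.Equivalence using (EqClosure)
open import Relation.Binary.Core using (Rel)
open import Relation.Binary.PropositionalEquality.Core using (_≡_; _≢_)
open import Relation.Nullary.Negation.Core using (¬_)

private
  variable
    a ℓ : Level
    A : Set a

-- The quotient of A by the equivalence relation R has exactly k elements.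
HasClasses : {A : Set a} → Rel A ℓ → ℕ → Set _
HasClasses {A = A} R k =
  Σ (A → Fin k) λ c →
    Surjective _≡_ _≡_ c × (∀ x y → R x y ⇔ c x ≡ c y)

-- The orbit of x under iteration of f is a cycle of length exactly d.
HasPeriod : (A → A) → A → ℕ → Set _
HasPeriod f x d =
  0 < d × fold x f d ≡ x × (∀ i → 0 < i → i < d → fold x f i ≢ x)

-- An embedding of a graph in a closed surface whose complementary
-- components are open discs is given, up to homeomorphism, by its flags:
-- the triangles of the barycentric subdivision, i.e. the (vertex, edge,
-- face) corners.  The four flags of an edge are told apart by an end and
-- a side of that edge.  Each flag has three neighbours, differing from it
-- only in the vertex (ρ₀), only in the edge (ρ₁), or only in the face (ρ₂).

Flag : ℕ → Set
Flag n = Fin n × Bool × Bool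

ρ₀ : ∀ {n} → Flag n → Flag n
ρ₀ (e , end , side) = (e , not end , side)

ρ₂ : ∀ {n} → Flag n → Flag n
ρ₂ (e , end , side) = (e , end , not side)

record CellularEmbedding : Set where
  field
    #edges        : ℕ
    ρ₁            : Flag #edges → Flag #edges
    ρ₁-involutive : ∀ x → ρ₁ (ρ₁ x) ≡ x
    ρ₁-fixfree    : ∀ x → ρ₁ x ≢ x
    nonempty      : 0 < #edges
    connected     : ∀ x y →
      EqClosure (λ z w → (ρ₀ z ≡ w) ⊎ (ρ₁ z ≡ w) ⊎ (ρ₂ z ≡ w)) x y

  F : Set
  F = Flag #edges

  edge : F → Fin #edges
  edge = proj₁

  -- Vertices and faces are the classes of flags under these relations.
  SameVertex SameFace : Rel F _
  SameVertex = EqClosure (λ z w → (ρ₁ z ≡ w) ⊎ (ρ₂ z ≡ w))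
  SameFace   = EqClosure (λ z w → (ρ₀ z ≡ w) ⊎ (ρ₁ z ≡ w))

  -- Below, a flag also stands for its vertex or for its face.

  VertexOfFace : F → F → Set
  VertexOfFace v f = ∃ λ z → SameVertex v z × SameFace z f

  EdgeOfFace : Fin #edges → F → Set
  EdgeOfFace e f = ∃ λ z → e ≡ edge z × SameFace z f

  VertexOfEdge : F → Fin #edges → Set
  VertexOfEdge v e = ∃ λ z → SameVertex v z × edge z ≡ e

  -- The closure of an open face is a closed disc iff its boundary walk is
  -- a simple closed curve, i.e. visits no vertex and no edge twice.
  FacesAreClosedDiscs : Set
  FacesAreClosedDiscs = ∀ x y → SameFace x y →
    (SameVertex x y → y ≡ x ⊎ y ≡ ρ₁ x) ×
    (edge x ≡ edge y → y ≡ x ⊎ y ≡ ρ₀ x)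

  module _ (f g : F) where

    CommonVertex : F → Set
    CommonVertex v = VertexOfFace v f × VertexOfFace v g

    CommonEdge : Fin #edges → Set
    CommonEdge e = EdgeOfFace e f × EdgeOfFace e g

    -- An edge contains its ends, so this also excludes a common edge.
    MeetInNothing : Set
    MeetInNothing = ∀ v → ¬ CommonVertex v

    MeetInVertex : Set
    MeetInVertex = ∃ λ v →
      (∀ w → CommonVertex w ⇔ SameVertex w v) × (∀ e → ¬ CommonEdge e)

    MeetInEdge : Set
    MeetInEdge = ∃ λ e →
      (∀ w → CommonVertex w ⇔ VertexOfEdge w e) ×
      (∀ e′ → CommonEdge e′ ⇔ e′ ≡ e)

  FacesMeetProperly : Set
  FacesMeetProperly = ∀ f g → ¬ SameFace f g →
    MeetInNothing f g ⊎ MeetInVertex f g ⊎ MeetInEdge f g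

record Map : Set where
  field
    embedding  : CellularEmbedding
  open CellularEmbedding embedding public
  field
    closedDiscs : FacesAreClosedDiscs
    meetProper  : FacesMeetProperly

open Map

Orientable : Map → Set
Orientable X = Σ (F X → Bool) λ o → ∀ x →
  (o (ρ₀ x) ≡ not (o x)) × (o (ρ₁ X x) ≡ not (o x)) × (o (ρ₂ x) ≡ not (o x))

-- The torus is the closed connected orientable surface with V - E + F = 0.
Toroidal : Map → Set
Toroidal X = Orientable X ×
  (∃ λ #V → ∃ λ #F →
    HasClasses (SameVertex X) #V × HasClasses (SameFace X) #F ×
    #V + #F ≡ #edges X)

-- Rotation about the vertex of a flag, to the next edge and next face.
turn : (X : Map) → F X → F X
turn X = ρ₁ X ∘ ρ₂

-- Rotation about the face of a flag, to the next vertex and next edge.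
walk : (X : Map) → F X → F X
walk X = ρ₁ X ∘ ρ₀

Valence : (X : Map) → F X → ℕ → Set
Valence X = HasPeriod (turn X)

FaceSize : (X : Map) → F X → ℕ → Set
FaceSize X = HasPeriod (walk X)

-- The sizes of the faces met in one full turn about the vertex of x.
FaceCycle : (X : Map) → F X → List ℕ → Set
FaceCycle X x ps =
  Valence X x (length ps) ×
  (∀ i → FaceSize X (fold x (turn X) (toℕ i)) (lookup ps i))

-- Cyclic sequences are taken up to rotation and reflection: the flags y
-- at a vertex run over all starting faces and both directions of turning.
SemiEquivelar : Map → Set
SemiEquivelar X = ∃ λ ps → ∀ x → ∃ λ y → SameVertex X x y × FaceCycle X y ps

-- The flags x of e run over both ends and both sides, so that neither
-- {m,l} nor {u,v} is ordered.
EdgeSymbol : (X : Map) → Fin (#edges X) → (m l u v : ℕ) → Set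
EdgeSymbol X e m l u v = ∃ λ x → edge X x ≡ e ×
  FaceSize X x m × FaceSize X (ρ₂ x) l × Valence X x u × Valence X (ρ₀ x) v

HasEdgeSymbol : Map → (m l u v : ℕ) → Set
HasEdgeSymbol X m l u v = ∀ e → EdgeSymbol X e m l u v

record PreservesFlags (Z X : Map) (φ : F Z → F X) : Set where
  field
    ρ₀-homo : ∀ x → φ (ρ₀ x) ≡ ρ₀ (φ x)
    ρ₁-homo : ∀ x → φ (ρ₁ Z x) ≡ ρ₁ X (φ x)
    ρ₂-homo : ∀ x → φ (ρ₂ x) ≡ ρ₂ (φ x)

-- The injectivity conditions say that the map is unbranched over the
-- vertices and over the centres of the faces; at the edges this is
-- automatic.
record Covering (Z X : Map) : Set where
  field
    η            : F Z → F X
    homo         : PreservesFlags Z X η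
    surjective   : Surjective _≡_ _≡_ η
    vertex-local : ∀ x y → SameVertex Z x y → η x ≡ η y → x ≡ y
    face-local   : ∀ x y → SameFace Z x y → η x ≡ η y → x ≡ y

record Automorphism (X : Map) : Set where
  field
    φ         : F X → F X
    homo      : PreservesFlags X X φ
    bijective : Bijective _≡_ _≡_ φ

SameEdgeOrbit : (X : Map) → Rel (Fin (#edges X)) _
SameEdgeOrbit X e e′ = Σ (Automorphism X) λ α →
  ∀ x → edge X x ≡ e → edge X (Automorphism.φ α x) ≡ e′

EdgeOrbital : ℕ → Map → Set
EdgeOrbital k X = HasClasses (SameEdgeOrbit X) k

module Submission where

-- The number of edges of Y is attained by a k-edge orbital cover of X, so it
-- suffices to find the least number that is.  This is constructive because
-- for each n it is decidable whether such a cover with n edges exists: a map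
-- with n edges is an involution ρ₁ of 4n flags, and coverings, colourings and
-- automorphisms are functions between finite sets, so that everything can be
-- found by exhaustive search.  Without function extensionality, a search
-- through functions only meets each function up to pointwise equality.  It
-- therefore needs predicates that respect pointwise equality, and
-- decidability and this invariance are carried along together.

open import Defs
open import Data.Bool.Base using (Bool; true; false)
import Data.Bool.Properties as Bool
open import Data.Fin.Base using (Fin)
import Data.Fin.Properties as Fin
open import Data.List.Base using (List; []; _∷_; length; allFin; cartesianProduct; lookup)
open import Data.List.Membership.Propositional using (_∈_; lose)
open import Data.List.Membership.Propositional.Properties using (∈-allFin; ∈-cartesianProduct⁺)
open import Data.List.Relation.Unary.All as All using (all?)
open import Data.List.Relation.Unary.Any using (here; there; any?; index; satisfied)
open import Data.List.Relation.Unary.Any.Properties using (lookup-index)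
open import Data.Nat.Base using (ℕ; zero; suc; _≤_; _<_)
open import Data.Nat.Induction using (<-rec)
open import Data.Nat.Properties using (_<?_; anyUpTo?; ≮⇒≥)
open import Data.Product.Base using (Σ; ∃; _×_; _,_; proj₁; proj₂; uncurry)
open import Data.Product.Properties using (≡-dec)
open import Data.Product.Relation.Binary.Pointwise.NonDependent using (_×ₛ_)
open import Data.Sum.Base as Sum using (_⊎_; inj₁; inj₂; [_,_]′)
open import Data.Unit.Base using (⊤; tt)
open import Data.Vec.Base as Vec using (Vec; []; _∷_)
open import Data.Vec.Properties using (lookup∘tabulate)
open import Function.Base using (_∘_; id)
open import Function.Bundles using (_⇔_; mk⇔; Equivalence)
open import Function.Consequences.Propositional
  using (strictlySurjective⇒surjective; surjective⇒strictlySurjective)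
open import Function.Definitions using (Injective; Surjective; StrictlySurjective)
open import Level using (0ℓ)
open import Relation.Binary.Bundles using (Setoid)
import Relation.Binary.Construct.On as On
open import Relation.Binary.Construct.Closure.Equivalence using (EqClosure)
open import Relation.Binary.Construct.Closure.ReflexiveTransitive
  using (Star; ε; _◅_; _◅◅_)
open import Relation.Binary.Construct.Closure.Symmetric using (SymClosure; fwd; bwd)
open import Relation.Binary.Definitions using (DecidableEquality; _Respects_)
open import Relation.Binary.PropositionalEquality
  using (_≡_; _≢_; refl; sym; trans; cong; setoid; _→-setoid_)
open import Relation.Nullary.Decidable.Core
  using (Dec; yes; no; map′; ¬?; _×-dec_; _⊎-dec_; _→-dec_)
open import Relation.Nullary.Negation.Core using (¬_)
open import Relation.Unary using (Decidable)

open Setoid using (Carrier)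
open Equivalence using (to; from)
open Map using (F; #edges; ρ₁)

-- Finite types.

record Finite (A : Set) : Set where
  field
    elements : List A
    complete : ∀ x → x ∈ elements

open Finite

Fin-finite : ∀ n → Finite (Fin n)
Fin-finite n = record { elements = allFin n ; complete = ∈-allFin }

Bool-finite : Finite Bool
Bool-finite = record
  { elements = false ∷ true ∷ []
  ; complete = λ { false → here refl ; true → there (here refl) }
  }

×-finite : ∀ {A B} → Finite A → Finite B → Finite (A × B)
×-finite A B = record
  { elements = cartesianProduct (elements A) (elements B)
  ; complete = λ (a , b) → ∈-cartesianProduct⁺ (complete A a) (complete B b)
  }

Flag-finite : ∀ n → Finite (Flag n)
Flag-finite n = ×-finite (Fin-finite n) (×-finite Bool-finite Bool-finite)

_≟ᶠ_ : ∀ {n} → DecidableEquality (Flag n)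
_≟ᶠ_ = ≡-dec Fin._≟_ (≡-dec Bool._≟_ Bool._≟_)

-- Effective predicates and their closure properties.

record Effective (Γ : Setoid 0ℓ 0ℓ) (P : Carrier Γ → Set) : Set where
  field
    dec  : Decidable P
    resp : P Respects (Setoid._≈_ Γ)

open Effective

Extensional : (Γ : Setoid 0ℓ 0ℓ) {A : Set} → (Carrier Γ → A) → Set
Extensional Γ u = ∀ {γ δ} → Setoid._≈_ Γ γ δ → u γ ≡ u δ

-- Serves both to weaken a predicate to a context with further variables, with `g` a projection, and
-- to fix some of the variables, with `g` a pairing.
pullback : ∀ {Γ Δ P} (g : Carrier Δ → Carrier Γ) →
  (∀ {γ δ} → Setoid._≈_ Δ γ δ → Setoid._≈_ Γ (g γ) (g δ)) →
  Effective Γ P → Effective Δ (P ∘ g)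
pullback g g-cong p = record { dec = dec p ∘ g ; resp = resp p ∘ g-cong }

-- For terms whose function and argument both vary, such as `f (f x)`: the argument is changed
-- first, with the function held at `γ`, and then the function.
apply : ∀ Γ {A B} (f : Carrier Γ → A → B) {u : Carrier Γ → A} →
  (∀ a → Extensional Γ (λ γ → f γ a)) → Extensional Γ u → Extensional Γ (λ γ → f γ (u γ))
apply Γ f f-ext u-ext {γ} e = trans (cong (f γ) (u-ext e)) (f-ext _ e)

Searchable : Setoid 0ℓ 0ℓ → Set₁
Searchable S = ∀ {P} → Effective S P → Dec (∃ P)

module _ {Γ : Setoid 0ℓ 0ℓ} where
  open Setoid Γ using () renaming (Carrier to C; _≈_ to _≈_; sym to ≈-sym; refl to ≈-refl)

  constᵉ : ∀ {A} → Dec A → Effective Γ (λ _ → A)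
  constᵉ a? = record { dec = λ _ → a? ; resp = λ _ → id }

  infix  3 _⇔ᵉ_ ¬ᵉ_
  infixr 2 _×ᵉ_
  infixr 1 _⊎ᵉ_
  infixr 0 _→ᵉ_

  _×ᵉ_ : ∀ {P Q : C → Set} → Effective Γ P → Effective Γ Q → Effective Γ (λ γ → P γ × Q γ)
  p ×ᵉ q = record
    { dec  = λ γ → dec p γ ×-dec dec q γ
    ; resp = λ e (x , y) → resp p e x , resp q e y
    }

  _⊎ᵉ_ : ∀ {P Q : C → Set} → Effective Γ P → Effective Γ Q → Effective Γ (λ γ → P γ ⊎ Q γ)
  p ⊎ᵉ q = record
    { dec  = λ γ → dec p γ ⊎-dec dec q γ
    ; resp = λ e → Sum.map (resp p e) (resp q e)
    }

  _→ᵉ_ : ∀ {P Q : C → Set} → Effective Γ P → Effective Γ Q → Effective Γ (λ γ → P γ → Q γ)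
  p →ᵉ q = record
    { dec  = λ γ → dec p γ →-dec dec q γ
    ; resp = λ e f → resp q e ∘ f ∘ resp p (≈-sym e)
    }

  ¬ᵉ_ : ∀ {P : C → Set} → Effective Γ P → Effective Γ (λ γ → ¬ P γ)
  ¬ᵉ p = record { dec = λ γ → ¬? (dec p γ) ; resp = λ e f → f ∘ resp p (≈-sym e) }

  via : ∀ {P Q : C → Set} → (∀ γ → P γ ⇔ Q γ) → Effective Γ P → Effective Γ Q
  via P⇔Q p = record
    { dec  = λ γ → map′ (to (P⇔Q γ)) (from (P⇔Q γ)) (dec p γ)
    ; resp = λ e → to (P⇔Q _) ∘ resp p e ∘ from (P⇔Q _)
    }

  _⇔ᵉ_ : ∀ {P Q : C → Set} → Effective Γ P → Effective Γ Q → Effective Γ (λ γ → P γ ⇔ Q γ)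
  p ⇔ᵉ q = via (λ _ → mk⇔ (uncurry mk⇔) (λ e → to e , from e)) ((p →ᵉ q) ×ᵉ (q →ᵉ p))

  ∀ᵉ : ∀ {A} {P : C → A → Set} → Finite A →
    (∀ a → Effective Γ (λ γ → P γ a)) → Effective Γ (λ γ → ∀ a → P γ a)
  ∀ᵉ A p = record
    { dec  = λ γ → map′ (λ ps a → All.lookup ps (complete A a)) (λ f → All.tabulate (λ {a} _ → f a))
                        (all? (λ a → dec (p a) γ) (elements A))
    ; resp = λ e f a → resp (p a) e (f a)
    }

  ∃ᵉ : ∀ {A} {P : C → A → Set} → Finite A →
    (∀ a → Effective Γ (λ γ → P γ a)) → Effective Γ (λ γ → ∃ (P γ))
  ∃ᵉ A p = record
    { dec  = λ γ → map′ satisfied (λ (a , x) → lose (complete A a) x)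
                        (any? (λ a → dec (p a) γ) (elements A))
    ; resp = λ e (a , x) → a , resp (p a) e x
    }

  -- The bound variable becomes a further variable of the context. With `γ` fixed, the body is
  -- effective on `S` by reflexivity in `Γ`; when `γ` is replaced by an equal point, the same
  -- witness `s` serves.
  ∃ˢᵉ : ∀ {S : Setoid 0ℓ 0ℓ} {P : C → Carrier S → Set} → Searchable S →
    Effective (Γ ×ₛ S) (uncurry P) → Effective Γ (λ γ → ∃ (P γ))
  ∃ˢᵉ {S} search p = record
    { dec  = λ γ → search (pullback (γ ,_) (≈-refl ,_) p)
    ; resp = λ e (s , x) → s , resp p (e , Setoid.refl S) x
    }

  equalᵉ : ∀ {A} {u v : C → A} → DecidableEquality A →
    Extensional Γ u → Extensional Γ v → Effective Γ (λ γ → u γ ≡ v γ)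
  equalᵉ _≟_ u v = record
    { dec  = λ _ → _ ≟ _
    ; resp = λ e x → trans (sym (u e)) (trans x (v e))
    }

  -- `Surjective` also quantifies over all points equal to the preimage. The strict form does not,
  -- so that `∀ᵉ` and `∃ᵉ` apply to it directly.
  surjectiveᵉ : ∀ {A B} {f : C → A → B} → Finite A → Finite B → DecidableEquality B →
    (∀ a → Extensional Γ (λ γ → f γ a)) → Effective Γ (λ γ → Surjective _≡_ _≡_ (f γ))
  surjectiveᵉ {f = f} A B _≟_ f-ext =
    via {P = λ γ → StrictlySurjective _≡_ (f γ)}
        (λ _ → mk⇔ strictlySurjective⇒surjective surjective⇒strictlySurjective)
        (∀ᵉ B λ _ → ∃ᵉ A λ a → equalᵉ _≟_ (f-ext a) (λ _ → refl))

  injectiveᵉ : ∀ {A B} {f : C → A → B} → Finite A → DecidableEquality A → DecidableEquality B →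
    (∀ a → Extensional Γ (λ γ → f γ a)) → Effective Γ (λ γ → Injective _≡_ _≡_ (f γ))
  injectiveᵉ A _≟₁_ _≟₂_ f-ext =
    via (λ _ → mk⇔ (λ h {x} {y} → h x y) (λ h x y → h {x} {y}))
        (∀ᵉ A λ x → ∀ᵉ A λ y → equalᵉ _≟₂_ (f-ext x) (f-ext y) →ᵉ constᵉ (x ≟₁ y))

-- Warshall's algorithm: Via vs relates the ends of the paths of R all of whose
-- intermediate points (and possibly more of their points) lie in vs.
module _ {A : Set} (R : A → A → Set) where

  Via : List A → A → A → Set
  Via []       x y = x ≡ y ⊎ R x y
  Via (v ∷ vs) x y = Via vs x y ⊎ (Via vs x v × Via vs v y)

  Via⇒Star : ∀ vs {x y} → Via vs x y → Star R x y
  Via⇒Star []       (inj₁ refl)    = ε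
  Via⇒Star []       (inj₂ r)       = r ◅ ε
  Via⇒Star (v ∷ vs) (inj₁ p)       = Via⇒Star vs p
  Via⇒Star (v ∷ vs) (inj₂ (p , q)) = Via⇒Star vs p ◅◅ Via⇒Star vs q

  base⇒Via : ∀ vs {x y} → x ≡ y ⊎ R x y → Via vs x y
  base⇒Via []       r = r
  base⇒Via (v ∷ vs) r = inj₁ (base⇒Via vs r)

  -- If `v` is the head of the list, any loop at `v` is dropped and the two paths are joined there.
  -- Otherwise the head may be visited by one path, and the recursion works on the piece next to
  -- `v`; or by both, and the detour from the head through `v` back to the head is cut out.
  Via-trans : ∀ {vs v x y} → v ∈ vs → Via vs x v → Via vs v y → Via vs x y
  Via-trans (here refl) p q = inj₂ ([ id , proj₁ ]′ p , [ id , proj₂ ]′ q)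
  Via-trans (there i) (inj₁ p)        (inj₁ q)        = inj₁ (Via-trans i p q)
  Via-trans (there i) (inj₁ p)        (inj₂ (q , q′)) = inj₂ (Via-trans i p q , q′)
  Via-trans (there i) (inj₂ (p , p′)) (inj₁ q)        = inj₂ (p , Via-trans i p′ q)
  Via-trans (there i) (inj₂ (p , _))  (inj₂ (_ , q))  = inj₂ (p , q)

  -- Every point is listed in `elements A-finite`, so a path can be built up step by step with
  -- `Via-trans` at each intermediate point.
  Star⇒Via : (A-finite : Finite A) → ∀ {x y} → Star R x y → Via (elements A-finite) x y
  Star⇒Via A-finite ε       = base⇒Via _ (inj₁ refl)
  Star⇒Via A-finite (r ◅ s) =
    Via-trans (complete A-finite _) (base⇒Via _ (inj₂ r)) (Star⇒Via A-finite s)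

module _ {Γ : Setoid 0ℓ 0ℓ} {A : Set} (_≟_ : DecidableEquality A) where

  Viaᵉ : ∀ {R : Carrier Γ → A → A → Set} → (∀ x y → Effective Γ (λ γ → R γ x y)) →
    ∀ vs x y → Effective Γ (λ γ → Via (R γ) vs x y)
  Viaᵉ r []       x y = constᵉ (x ≟ y) ⊎ᵉ r x y
  Viaᵉ r (v ∷ vs) x y = Viaᵉ r vs x y ⊎ᵉ (Viaᵉ r vs x v ×ᵉ Viaᵉ r vs v y)

  -- For a fixed list, `Via` is a finite combination of instances of the relation and of equality by
  -- `⊎` and `×`. Decidability and invariance in `γ` therefore both pass to the closure.
  EqClosureᵉ : ∀ {R : Carrier Γ → A → A → Set} → Finite A →
    (∀ x y → Effective Γ (λ γ → R γ x y)) → ∀ x y → Effective Γ (λ γ → EqClosure (R γ) x y)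
  EqClosureᵉ {R} A-finite r x y =
    via (λ γ → mk⇔ (Via⇒Star (SymClosure (R γ)) _) (Star⇒Via (SymClosure (R γ)) A-finite))
        (Viaᵉ SymClosureᵉ (elements A-finite) x y)
    where
    SymClosureᵉ : ∀ x y → Effective Γ (λ γ → SymClosure (R γ) x y)
    SymClosureᵉ x y =
      via (λ _ → mk⇔ [ fwd , bwd ]′ λ { (fwd r) → inj₁ r ; (bwd r) → inj₂ r })
          (r x y ⊎ᵉ r y x)

-- Exhaustive search through vectors, functions and subsets.

any-finite? : ∀ {A} {P : A → Set} → Finite A → Decidable P → Dec (∃ P)
any-finite? A p? = dec (∃ᵉ {Γ = setoid ⊤} A λ a → constᵉ (p? a)) tt

Vec-searchable : ∀ {A} → Finite A → ∀ n → Searchable (setoid (Vec A n))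
Vec-searchable A zero    p = map′ ([] ,_) (λ { ([] , x) → x }) (dec p [])
Vec-searchable A (suc n) p =
  map′ (λ (a , v , x) → a ∷ v , x) (λ { (a ∷ v , x) → a , v , x })
    (any-finite? A λ a → Vec-searchable A n (pullback (a ∷_) (cong (a ∷_)) p))

-- A function is coded by the vector of its values along `elements A-finite`. Decoding recovers it
-- only pointwise, so `resp` has to carry `P f` over to the decoded table.
→-searchable : ∀ {A B} → Finite A → Finite B → Searchable (A →-setoid B)
→-searchable {A} {B} A-finite B-finite {P} p =
  map′ (λ (v , x) → table v , x)
       (λ (f , x) → tabulation f , resp p (sym ∘ table∘tabulation f) x)
       (Vec-searchable B-finite _ (pullback table (λ { refl _ → refl }) p))
  where
  -- An element may be listed repeatedly; only the occurrence chosen by `complete` is ever read.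
  position : A → Fin (length (elements A-finite))
  position = index ∘ complete A-finite

  table : Vec B _ → A → B
  table v = Vec.lookup v ∘ position

  tabulation : (A → B) → Vec B _
  tabulation f = Vec.tabulate (f ∘ lookup (elements A-finite))

  table∘tabulation : ∀ f a → table (tabulation f) a ≡ f a
  table∘tabulation f a =
    trans (lookup∘tabulate _ (position a)) (cong f (sym (lookup-index (complete A-finite a))))

-- Equality ignores the proof component, since proofs of `P s` need not be unique.
Subset : (S : Setoid 0ℓ 0ℓ) → (Carrier S → Set) → Setoid 0ℓ 0ℓ
Subset S P = On.setoid {B = Σ (Carrier S) P} S proj₁

Subset-searchable : ∀ {S P} → Effective S P → Searchable S → Searchable (Subset S P)
Subset-searchable {S} {P} p search {Q} q =
  map′ (λ (s , x , y) → (s , x) , y) (λ ((s , x) , y) → s , x , y)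
       (search (record { dec = dec-Σ ; resp = resp-Σ }))
  where
  dec-Σ : Decidable (λ s → Σ (P s) λ x → Q (s , x))
  dec-Σ s with dec p s
  ... | no ¬x = no (¬x ∘ proj₁)
  -- Testing `Q` at the single proof `x` suffices: all pairs over `s` are equal in `Subset S P`, and
  -- `Q` respects that equality.
  ... | yes x = map′ (x ,_) (λ (_ , y) → resp q (Setoid.refl S) y) (dec q (s , x))

  resp-Σ : (λ s → Σ (P s) λ x → Q (s , x)) Respects (Setoid._≈_ S)
  resp-Σ e (x , y) = resp p e x , resp q e y

-- Search through the maps with a given number of edges.

-- With `n` fixed the flags form a fixed finite type, and `ρ₁` is the only datum to search for; the
-- remaining fields of `CellularEmbedding` are conditions on it.
Embeddings : ℕ → Setoid 0ℓ 0ℓ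
Embeddings n = Subset (Flag n →-setoid Flag n) λ f →
  (∀ x → f (f x) ≡ x) × (∀ x → f x ≢ x) × 0 < n ×
  (∀ x y → EqClosure (λ z w → (ρ₀ z ≡ w) ⊎ (f z ≡ w) ⊎ (ρ₂ z ≡ w)) x y)

toEmbedding : ∀ {n} → Carrier (Embeddings n) → CellularEmbedding
toEmbedding {n} (f , inv , fixfree , ne , conn) = record
  { #edges = n ; ρ₁ = f ; ρ₁-involutive = inv ; ρ₁-fixfree = fixfree
  ; nonempty = ne ; connected = conn }

Maps : ℕ → Setoid 0ℓ 0ℓ
Maps n = Subset (Embeddings n) λ γ →
  let open CellularEmbedding (toEmbedding γ) in FacesAreClosedDiscs × FacesMeetProperly

toMap : ∀ {n} → Carrier (Maps n) → Map
toMap (γ , discs , meet) = record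
  { embedding = toEmbedding γ ; closedDiscs = discs ; meetProper = meet }

-- By eta for records, `toMap (fromMap X)` is definitionally `X`, so facts about `X` need no
-- transport.
fromMap : (X : Map) → Carrier (Maps (#edges X))
fromMap X =
  (X.ρ₁ , X.ρ₁-involutive , X.ρ₁-fixfree , X.nonempty , X.connected) , X.closedDiscs , X.meetProper
  where module X = Map X

Embeddings-searchable : ∀ n → Searchable (Embeddings n)
Embeddings-searchable n = Subset-searchable
  (  (∀ᵉ flags λ x → equalᵉ _≟ᶠ_
        (apply (Flag n →-setoid Flag n) id (λ a e → e a) (λ e → e x)) (λ _ → refl))
  ×ᵉ (∀ᵉ flags λ x → ¬ᵉ equalᵉ _≟ᶠ_ (λ e → e x) (λ _ → refl))
  ×ᵉ constᵉ (0 <? n)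
  ×ᵉ (∀ᵉ flags λ x → ∀ᵉ flags λ y → EqClosureᵉ _≟ᶠ_ flags (λ z w →
        constᵉ (ρ₀ z ≟ᶠ w) ⊎ᵉ equalᵉ _≟ᶠ_ (λ e → e z) (λ _ → refl) ⊎ᵉ constᵉ (ρ₂ z ≟ᶠ w)) x y))
  (→-searchable flags flags)
  where
  flags = Flag-finite n

module _ {n : ℕ} where
  private
    Γ = Embeddings n
    flags = Flag-finite n
    edges = Fin-finite n
    open module E γ = CellularEmbedding (toEmbedding {n} γ) using
      (SameVertex; SameFace; VertexOfFace; EdgeOfFace; VertexOfEdge;
       CommonVertex; CommonEdge; FacesAreClosedDiscs; FacesMeetProperly)

  SameVertexᵉ : ∀ x y → Effective Γ (λ γ → SameVertex γ x y)
  SameVertexᵉ = EqClosureᵉ _≟ᶠ_ flags λ z w →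
    equalᵉ _≟ᶠ_ (λ e → e z) (λ _ → refl) ⊎ᵉ constᵉ (ρ₂ z ≟ᶠ w)

  SameFaceᵉ : ∀ x y → Effective Γ (λ γ → SameFace γ x y)
  SameFaceᵉ = EqClosureᵉ _≟ᶠ_ flags λ z w →
    constᵉ (ρ₀ z ≟ᶠ w) ⊎ᵉ equalᵉ _≟ᶠ_ (λ e → e z) (λ _ → refl)

  VertexOfEdgeᵉ : ∀ v e → Effective Γ (λ γ → VertexOfEdge γ v e)
  VertexOfEdgeᵉ v e = ∃ᵉ flags λ z → SameVertexᵉ v z ×ᵉ constᵉ (proj₁ z Fin.≟ e)

  CommonVertexᵉ : ∀ f g v → Effective Γ (λ γ → CommonVertex γ f g v)
  CommonVertexᵉ f g v = vertexOfFaceᵉ f ×ᵉ vertexOfFaceᵉ g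
    where
    vertexOfFaceᵉ : ∀ f → Effective Γ (λ γ → VertexOfFace γ v f)
    vertexOfFaceᵉ f = ∃ᵉ flags λ z → SameVertexᵉ v z ×ᵉ SameFaceᵉ z f

  CommonEdgeᵉ : ∀ f g e → Effective Γ (λ γ → CommonEdge γ f g e)
  CommonEdgeᵉ f g e = edgeOfFaceᵉ f ×ᵉ edgeOfFaceᵉ g
    where
    edgeOfFaceᵉ : ∀ f → Effective Γ (λ γ → EdgeOfFace γ e f)
    edgeOfFaceᵉ f = ∃ᵉ flags λ z → constᵉ (e Fin.≟ proj₁ z) ×ᵉ SameFaceᵉ z f

  FacesAreClosedDiscsᵉ : Effective Γ FacesAreClosedDiscs
  FacesAreClosedDiscsᵉ = ∀ᵉ flags λ x → ∀ᵉ flags λ y → SameFaceᵉ x y →ᵉ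
       (SameVertexᵉ x y →ᵉ constᵉ (y ≟ᶠ x) ⊎ᵉ equalᵉ _≟ᶠ_ (λ _ → refl) (λ e → e x))
    ×ᵉ constᵉ ((proj₁ x Fin.≟ proj₁ y) →-dec ((y ≟ᶠ x) ⊎-dec (y ≟ᶠ ρ₀ x)))

  FacesMeetProperlyᵉ : Effective Γ FacesMeetProperly
  FacesMeetProperlyᵉ = ∀ᵉ flags λ f → ∀ᵉ flags λ g → (¬ᵉ SameFaceᵉ f g) →ᵉ
       (∀ᵉ flags λ v → ¬ᵉ CommonVertexᵉ f g v)
    ⊎ᵉ (∃ᵉ flags λ v → (∀ᵉ flags λ w → CommonVertexᵉ f g w ⇔ᵉ SameVertexᵉ w v)
                    ×ᵉ (∀ᵉ edges λ e → ¬ᵉ CommonEdgeᵉ f g e))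
    ⊎ᵉ (∃ᵉ edges λ e → (∀ᵉ flags λ w → CommonVertexᵉ f g w ⇔ᵉ VertexOfEdgeᵉ w e)
                    ×ᵉ (∀ᵉ edges λ e′ → CommonEdgeᵉ f g e′ ⇔ᵉ constᵉ (e′ Fin.≟ e)))

Maps-searchable : ∀ n → Searchable (Maps n)
Maps-searchable n =
  Subset-searchable (FacesAreClosedDiscsᵉ ×ᵉ FacesMeetProperlyᵉ) (Embeddings-searchable n)

-- Deciding coverings and edge orbitality.

module _ {Γ m n} {Z : Carrier Γ → Carrier (Maps m)} {X : Carrier Γ → Carrier (Maps n)}
  {φ : Carrier Γ → Flag m → Flag n}
  (Z-ext : ∀ x → Extensional Γ (λ γ → ρ₁ (toMap (Z γ)) x))
  (X-ext : ∀ x → Extensional Γ (λ γ → ρ₁ (toMap (X γ)) x))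
  (φ-ext : ∀ x → Extensional Γ (λ γ → φ γ x)) where

  -- Source, target and `φ` may all depend on the context. This covers both coverings, whose target
  -- is fixed, and automorphisms, whose source and target vary together.
  PreservesFlagsᵉ : Effective Γ (λ γ → PreservesFlags (toMap (Z γ)) (toMap (X γ)) (φ γ))
  PreservesFlagsᵉ = via
    (λ γ → mk⇔
      (λ (h₀ , h₁ , h₂) → record { ρ₀-homo = h₀ ; ρ₁-homo = h₁ ; ρ₂-homo = h₂ })
      (λ h → let open PreservesFlags h in ρ₀-homo , ρ₁-homo , ρ₂-homo))
    (  (∀ᵉ flags λ x → equalᵉ _≟ᶠ_ (φ-ext (ρ₀ x)) (cong ρ₀ ∘ φ-ext x))
    ×ᵉ (∀ᵉ flags λ x → equalᵉ _≟ᶠ_ (apply Γ φ φ-ext (Z-ext x))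
                                    (apply Γ (λ γ → ρ₁ (toMap (X γ))) X-ext (φ-ext x)))
    ×ᵉ (∀ᵉ flags λ x → equalᵉ _≟ᶠ_ (φ-ext (ρ₂ x)) (cong ρ₂ ∘ φ-ext x)))
    where
    flags = Flag-finite m

module _ {n : ℕ} where
  private
    flags = Flag-finite n
    edges = Fin-finite n

  Coveringᵉ : ∀ X → Effective (Maps n) (λ γ → Covering (toMap γ) X)
  Coveringᵉ X = via
    (λ γ → mk⇔
      (λ (η , h , s , v , f) → record
        { η = η ; homo = h ; surjective = s ; vertex-local = v ; face-local = f })
      (λ c → let open Covering c in η , homo , surjective , vertex-local , face-local))
    (∃ˢᵉ (→-searchable flags (Flag-finite (#edges X)))
      (  PreservesFlagsᵉ {Z = proj₁} {X = λ _ → fromMap X}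
           (λ x (e , _) → e x) (λ _ _ → refl) (λ x (_ , e) → e x)
      ×ᵉ surjectiveᵉ flags (Flag-finite (#edges X)) _≟ᶠ_ (λ x (_ , e) → e x)
      ×ᵉ locallyInjectiveᵉ SameVertexᵉ
      ×ᵉ locallyInjectiveᵉ SameFaceᵉ))
    where
    Γ = Maps n ×ₛ (Flag n →-setoid F X)

    locallyInjectiveᵉ : {R : Carrier (Embeddings n) → Flag n → Flag n → Set} →
      (∀ x y → Effective (Embeddings n) (λ γ → R γ x y)) →
      Effective Γ (λ (γ , η) → ∀ x y → R (proj₁ γ) x y → η x ≡ η y → x ≡ y)
    locallyInjectiveᵉ r = ∀ᵉ flags λ x → ∀ᵉ flags λ y →
      pullback {Γ = Embeddings n} (proj₁ ∘ proj₁) proj₁ (r x y) →ᵉ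
      equalᵉ _≟ᶠ_ (λ (_ , e) → e x) (λ (_ , e) → e y) →ᵉ
      constᵉ (x ≟ᶠ y)

  SameEdgeOrbitᵉ : ∀ e e′ → Effective (Maps n) (λ γ → SameEdgeOrbit (toMap γ) e e′)
  SameEdgeOrbitᵉ e e′ = via
    (λ γ → mk⇔
      (λ (φ , h , b , m) → record { φ = φ ; homo = h ; bijective = b } , m)
      (λ (α , m) → let open Automorphism α in φ , homo , bijective , m))
    (∃ˢᵉ (→-searchable flags flags)
      (  PreservesFlagsᵉ {Z = proj₁} {X = proj₁}
           (λ x (e , _) → e x) (λ x (e , _) → e x) φ-ext
      ×ᵉ (injectiveᵉ flags _≟ᶠ_ _≟ᶠ_ φ-ext ×ᵉ surjectiveᵉ flags flags _≟ᶠ_ φ-ext)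
      ×ᵉ (∀ᵉ flags λ x →
            constᵉ (proj₁ x Fin.≟ e) →ᵉ equalᵉ Fin._≟_ (λ (_ , eq) → cong proj₁ (eq x)) (λ _ → refl))))
    where
    φ-ext : ∀ x → Extensional (Maps n ×ₛ (Flag n →-setoid Flag n)) (λ (_ , φ) → φ x)
    φ-ext x (_ , e) = e x

  EdgeOrbitalᵉ : ∀ k → Effective (Maps n) (λ γ → EdgeOrbital k (toMap γ))
  EdgeOrbitalᵉ k = ∃ˢᵉ (→-searchable edges (Fin-finite k))
    (  surjectiveᵉ edges (Fin-finite k) Fin._≟_ (λ e (_ , eq) → eq e)
    ×ᵉ (∀ᵉ edges λ e → ∀ᵉ edges λ e′ →
          -- The orbit relation depends on the map alone, so it is weakened to the context that also
          -- contains the colouring of the edges.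
          pullback {Γ = Maps n} proj₁ proj₁ (SameEdgeOrbitᵉ e e′) ⇔ᵉ
          equalᵉ Fin._≟_ (λ (_ , eq) → eq e) (λ (_ , eq) → eq e′)))

-- The least number of edges.

-- Descent: a bounded search either finds a smaller number satisfying `P`, from which the recursion
-- continues, or shows that the present one is least.
least : ∀ {P : ℕ → Set} → Decidable P → ∀ {n} → P n → ∃ λ m → P m × (∀ l → P l → m ≤ l)
least {P} P? {n} = <-rec (λ n → P n → ∃ λ m → P m × (∀ l → P l → m ≤ l)) step n
  where
  step : ∀ n → _ → P n → _
  step n rec p with anyUpTo? P? n
  ... | yes (m , m<n , q) = rec m<n q
  ... | no ∄m             = n , p , λ l q → ≮⇒≥ λ l<n → ∄m (l , l<n , q)

theorem1p12 : (m k : ℕ) (X Y : Map) →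
    Toroidal X → EdgeOrbital m X →
    SemiEquivelar X ⊎ HasEdgeSymbol X 4 4 3 6 →
    Toroidal Y → EdgeOrbital k Y → Covering Y X →
    Σ Map λ Z → Covering Z X × EdgeOrbital k Z ×
    ((W : Map) → EdgeOrbital k W → Covering W X →
    Map.#edges Z ≤ Map.#edges W)
theorem1p12 m k X Y _ _ _ _ Y-orbital Y-covers = minimal-cover
  (least (λ n → Maps-searchable n (Coveringᵉ X ×ᵉ EdgeOrbitalᵉ k))
         (fromMap Y , Y-covers , Y-orbital))
  where
  Cover : ℕ → Set
  Cover n = Σ (Carrier (Maps n)) λ γ → Covering (toMap γ) X × EdgeOrbital k (toMap γ)

  minimal-cover : (∃ λ n → Cover n × (∀ l → Cover l → n ≤ l)) →
    Σ Map λ Z → Covering Z X × EdgeOrbital k Z ×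
    ((W : Map) → EdgeOrbital k W → Covering W X → #edges Z ≤ #edges W)
  minimal-cover (_ , (γ , γ-covers , γ-orbital) , minimal) =
    toMap γ , γ-covers , γ-orbital ,
    -- Any competitor `W` occurs, through `fromMap`, among the covers with `#edges W` edges, so
    -- minimality applies at that number.
    λ W W-orbital W-covers → minimal (#edges W) (fromMap W , W-covers , W-orbital)
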